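{- Let $G$ be a connected graph with $|L(G)|\geq 4$, and let $i\in\{0,1,2\}$. Assume that it is not the case that simultaneously $i=2$, $|L_o(G)|=3$ and $|L_e(G)|=2$. If $w(G)\leq \ell(G)-i$, then $\chi(G)\leq \ell(G)-i$.
   Context: All graphs are finite, simple and undirected. $L(G)$ denotes the set of all integers $m$ such that $G$ contains a cycle of length $m$; $L_o(G)$ and $L_e(G)$ denote the sets of odd, respectively even, elements of $L(G)$. $\ell(G)$ denotes the length of a longest cycle of $G$. $w(G)$ denotes the clique number of $G$ (the number of vertices of a largest clique) and $\chi(G)$ the chromatic number. -}

module Defs where

open import Data.Empty using (⊥-elim)
open import Data.Fin as Fin using (Fin)
import Data.Fin.Properties as Fin
open import Data.Fin.Subset using (Subset; _∈_; ∣_∣; ⊥)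
open import Data.Fin.Subset.Properties using (_∈?_; anySubset?; ∣p∣≤n; ∉⊥; ∣⊥∣≡0)
open import Data.List.Base as List using (List; []; _∷_; _∷ʳ_; length; filter; upTo)
open import Data.List.Extrema.Nat using (max; min; argmax-sel; argmin-sel; xs≤max; min≤xs; min≤⊤)
import Data.List.Membership.Propositional as List
open import Data.List.Membership.Propositional.Properties
  using (∈-filter⁺; ∈-filter⁻; ∈-upTo⁺; ∈-upTo⁻; ∈-lookup)
import Data.List.Relation.Unary.All as All
open import Data.List.Relation.Unary.Linked using (Linked; linked?)
open import Data.List.Relation.Unary.Unique.Propositional using (Unique)
import Data.List.Relation.Unary.Unique.DecPropositional as DecUnique
open import Data.List.Relation.Unary.Unique.Propositional.Properties using (filter⁺; upTo⁺)
open import Data.List.Relation.Unary.AllPairs using (_∷_)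
open import Data.Nat.Base using (ℕ; zero; suc; _≤_; s≤s)
open import Data.Nat.Divisibility using (_∣?_)
open import Data.Nat.Properties using (_≟_; _≤?_; _<?_; ≤-trans; ≮⇒≥)
open import Data.Product using (∃; _×_; _,_; proj₂)
open import Data.Sum.Base using (inj₁; inj₂)
open import Data.Vec.Base using (Vec; []; _∷_; toList; fromList; lookup; tabulate)
open import Data.Vec.Properties using (length-toList; toList∘fromList; lookup∘tabulate)
open import Function.Base using (_∘_; id)
open import Level using (0ℓ)
open import Relation.Binary.Construct.Closure.ReflexiveTransitive using (Star)
open import Relation.Binary.Core using (Rel)
open import Relation.Binary.Definitions using (Symmetric; Irreflexive) renaming (Decidable to Decidable₂)
open import Relation.Binary.PropositionalEquality
open import Relation.Nullary.Decidable using (Dec; yes; no; map′; ¬?; _×-dec_; _→-dec_)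
open import Relation.Unary using (Pred; Decidable)

record Graph : Set₁ where
  infix 4 _~_ _~?_
  field
    order : ℕ

  Vertex : Set
  Vertex = Fin order

  field
    _~_     : Rel Vertex 0ℓ
    _~?_    : Decidable₂ _~_
    ~-sym   : Symmetric _~_
    ~-irrefl : Irreflexive _≡_ _~_

anyVec? : ∀ {n p} m {P : Pred (Vec (Fin n) m) p} → Decidable P → Dec (∃ P)
anyVec? zero    P? = map′ ([] ,_) (λ { ([] , p) → p }) (P? [])
anyVec? (suc m) P? =
  map′ (λ { (x , xs , p) → x ∷ xs , p }) (λ { (x ∷ xs , p) → x , xs , p })
       (Fin.any? λ x → anyVec? m (P? ∘ (x ∷_)))

lookup-injective : ∀ {A : Set} {xs : List A} → Unique xs →
                   ∀ i j → List.lookup xs i ≡ List.lookup xs j → i ≡ j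
lookup-injective (_ ∷ _)  Fin.zero    Fin.zero    _  = refl
lookup-injective (px ∷ _) Fin.zero    (Fin.suc j) eq = ⊥-elim (All.lookup px (∈-lookup j) eq)
lookup-injective (px ∷ _) (Fin.suc i) Fin.zero    eq = ⊥-elim (All.lookup px (∈-lookup i) (sym eq))
lookup-injective (_ ∷ u)  (Fin.suc i) (Fin.suc j) eq = cong Fin.suc (lookup-injective u i j eq)

module _ (G : Graph) where
  open Graph G

  Connected : Set
  Connected = ∀ u v → Star _~_ u v

  closeUp : List Vertex → List Vertex
  closeUp []       = []
  closeUp (v ∷ vs) = v ∷ (vs ∷ʳ v)

  record IsCycle (c : List Vertex) : Set where
    constructor isCycle
    field
      3≤length : 3 ≤ length c
      distinct : Unique c
      adjacent : Linked _~_ (closeUp c)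

  HasCycle : ℕ → Set
  HasCycle m = ∃ λ c → IsCycle c × length c ≡ m

  IsClique : Subset order → Set
  IsClique S = ∀ u v → u ∈ S → v ∈ S → u ≢ v → u ~ v

  HasClique : ℕ → Set
  HasClique k = ∃ λ S → IsClique S × ∣ S ∣ ≡ k

  IsColouring : ∀ {k} → (Vertex → Fin k) → Set
  IsColouring f = ∀ u v → u ~ v → f u ≢ f v

  Colourable : ℕ → Set
  Colourable k = ∃ λ (f : Vertex → Fin k) → IsColouring f

  isCycle? : Decidable IsCycle
  isCycle? c =
    map′ (λ (l , d , a) → isCycle l d a) (λ (isCycle l d a) → l , d , a)
         (3 ≤? length c ×-dec DecUnique.unique? Fin._≟_ c ×-dec linked? _~?_ (closeUp c))

  hasCycle? : Decidable HasCycle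
  hasCycle? m =
    map′ (λ (v , p) → toList v , p , length-toList v)
         (λ { (c , p , refl) → fromList c , subst IsCycle (sym (toList∘fromList c)) p })
         (anyVec? m (isCycle? ∘ toList))

  isClique? : Decidable IsClique
  isClique? S = Fin.all? λ u → Fin.all? λ v →
    u ∈? S →-dec v ∈? S →-dec ¬? (u Fin.≟ v) →-dec u ~? v

  hasClique? : Decidable HasClique
  hasClique? k = anySubset? λ S → isClique? S ×-dec ∣ S ∣ ≟ k

  isColouring? : ∀ {k} → Decidable (IsColouring {k})
  isColouring? f = Fin.all? λ u → Fin.all? λ v → u ~? v →-dec ¬? (f u Fin.≟ f v)

  colourable? : Decidable Colourable
  colourable? k =
    map′ (λ (v , p) → lookup v , p)
         (λ (f , p) → tabulate f , λ u v u~v eq → p u v u~v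
           (trans (sym (lookup∘tabulate f u)) (trans eq (lookup∘tabulate f v))))
         (anyVec? order (isColouring? ∘ lookup))

  -- Finite sets of naturals are duplicate-free lists, so `length` is cardinality;
  -- no cycle is longer than `order` (see `hasCycle⇒≤order`).
  L : List ℕ
  L = filter hasCycle? (upTo (suc order))

  Lₑ : List ℕ
  Lₑ = filter (2 ∣?_) L

  Lₒ : List ℕ
  Lₒ = filter (¬? ∘ (2 ∣?_)) L

  -- The value for acyclic graphs is 0 by convention.
  ℓ : ℕ
  ℓ = max 0 L

  w : ℕ
  w = max 0 (filter hasClique? (upTo (suc order)))

  -- `order` itself always suffices (see `order-colourable`).
  χ : ℕ
  χ = min order (filter colourable? (upTo order))

  L-unique : Unique L
  L-unique = filter⁺ hasCycle? (upTo⁺ (suc order))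

  hasCycle⇒≤order : ∀ {m} → HasCycle m → m ≤ order
  hasCycle⇒≤order (c , p , refl) =
    Fin.injective⇒≤ (λ {i} {j} → lookup-injective (IsCycle.distinct p) i j)

  ∈-L⁺ : ∀ {m} → HasCycle m → m List.∈ L
  ∈-L⁺ h = ∈-filter⁺ hasCycle? (∈-upTo⁺ (s≤s (hasCycle⇒≤order h))) h

  ∈-L⁻ : ∀ {m} → m List.∈ L → HasCycle m
  ∈-L⁻ = proj₂ ∘ ∈-filter⁻ hasCycle? {xs = upTo (suc order)}

  ℓ-longest : ∀ {m} → HasCycle m → m ≤ ℓ
  ℓ-longest h = All.lookup (xs≤max 0 L) (∈-L⁺ h)

  ℓ-attained : ∀ {m} → HasCycle m → HasCycle ℓ
  ℓ-attained h@(_ , isCycle 3≤m _ _ , refl) with argmax-sel id 0 L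
  ... | inj₂ ℓ∈L = ∈-L⁻ ℓ∈L
  ... | inj₁ ℓ≡0 with () ← subst (3 ≤_) ℓ≡0 (≤-trans 3≤m (ℓ-longest h))

  w-largest : ∀ {k} → HasClique k → k ≤ w
  w-largest h@(S , _ , refl) =
    All.lookup (xs≤max 0 _) (∈-filter⁺ hasClique? (∈-upTo⁺ (s≤s (∣p∣≤n S))) h)

  w-attained : HasClique w
  w-attained with argmax-sel id 0 (filter hasClique? (upTo (suc order)))
  ... | inj₂ w∈  = proj₂ (∈-filter⁻ hasClique? {xs = upTo (suc order)} w∈)
  ... | inj₁ w≡0 = subst HasClique (sym w≡0) (⊥ , (λ _ _ u∈⊥ → ⊥-elim (∉⊥ u∈⊥)) , ∣⊥∣≡0 order)

  order-colourable : Colourable order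
  order-colourable = id , λ u v u~v u≡v → ~-irrefl u≡v u~v

  χ-colourable : Colourable χ
  χ-colourable with argmin-sel id order (filter colourable? (upTo order))
  ... | inj₁ χ≡n = subst Colourable (sym χ≡n) order-colourable
  ... | inj₂ χ∈  = proj₂ (∈-filter⁻ colourable? {xs = upTo order} χ∈)

  χ-least : ∀ {k} → Colourable k → χ ≤ k
  χ-least {k} h with k <? order
  ... | yes k<n = All.lookup (min≤xs order _) (∈-filter⁺ colourable? (∈-upTo⁺ k<n) h)
  ... | no  k≮n = ≤-trans (min≤⊤ order (filter colourable? (upTo order))) (≮⇒≥ k≮n)

{-# OPTIONS --safe #-}
module Submission where

-- Let d = ℓ ∸ i. As |L| ≥ 4 forces ℓ ≥ 6, we have d ≥ 4 and no cycle is longer than d + 2, and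
-- a graph with these properties and no (d+1)-clique is d-colourable. To see this, delete vertices
-- of degree below d. In what remains, take a longest path v₀ … vₜ x Q with v₀ ~ x and t maximal.
-- Then K = {v₀, …, vₜ} has at most d + 1 vertices, and v₀ misses at most one vertex of K ∪ {x}
-- other than itself. Pósa rotations therefore make every vertex of K the end of such a path, so all
-- neighbours of K lie in K ∪ {x}, and each vertex of K misses at most one other vertex there. As there
-- is no (d+1)-clique, K ∪ {x} has d + 2 vertices and two disjoint non-adjacent pairs, hence a
-- d-colouring; it is glued at the cut vertex x to one of the rest. Maximal objects are
-- only found up to double negation, which suffices because χ ≤ d is decidable.

open import Defs
open import Data.Empty using (⊥; ⊥-elim)
open import Data.Fin.Base as Fin using (Fin; fromℕ<; inject≤)
import Data.Fin.Permutation.Components as Perm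
import Data.Fin.Properties as Fin
import Data.Fin.Subset as Subset
import Data.Fin.Subset.Properties as Subset
open import Data.List.Base using (List; []; _∷_; [_]; _++_; _ʳ++_; length; filter; map; upTo; allFin; lookup)
import Data.List.Membership.DecPropositional as DecMembership
open import Data.List.Membership.Propositional using (_∈_; _∉_; find)
open import Data.List.Membership.Propositional.Properties
  using (∈-filter⁺; ∈-filter⁻; ∈-upTo⁺; ∈-allFin; ∈-lookup; ∈-map⁺; ∈-∃++; ∈-++⁺ˡ; ∈-++⁺ʳ; ∈-++⁻)
open import Data.List.Properties
  using (++-assoc; length-++; length-map; length-upTo; length-tabulate; filter-notAll)
open import Data.List.Relation.Binary.Permutation.Propositional
  using (_↭_; prep; swap; ↭-refl; ↭-sym; ↭-trans; ↭⇒↭ₛ)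
open import Data.List.Relation.Binary.Permutation.Propositional.Properties
  using (↭-length; ∈-resp-↭; All-resp-↭; shift; ++↭ʳ++; ∷↭∷ʳ)
  renaming (++⁺ˡ to ↭-++⁺ˡ; ++⁺ʳ to ↭-++⁺ʳ)
import Data.List.Relation.Binary.Permutation.Setoid.Properties as Permutationₛ
open import Data.List.Relation.Binary.Subset.Propositional using (_⊆_)
open import Data.List.Relation.Unary.All as All using (All; []; _∷_; all?)
open import Data.List.Relation.Unary.All.Properties as All using (¬All⇒Any¬)
open import Data.List.Relation.Unary.AllPairs as AllPairs using (AllPairs; []; _∷_)
open import Data.List.Relation.Unary.Any as Any using (here; there; index)
open import Data.List.Relation.Unary.Any.Properties using (lookup-index)
open import Data.List.Relation.Unary.Linked as Linked using (Linked; [-]; _∷_)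
open import Data.List.Relation.Unary.Unique.Propositional using (Unique)
import Data.List.Relation.Unary.Unique.Propositional.Properties as Unique
open import Data.Nat.Base using (ℕ; zero; suc; _+_; _≤_; _<_; _∸_; z≤n; s≤s)
open import Data.Nat.Properties
open import Data.Product using (∃; _×_; _,_; proj₁; proj₂)
open import Data.Sum.Base using (_⊎_; inj₁; inj₂)
open import Function.Base using (_∘_)
open import Relation.Binary.PropositionalEquality hiding ([_])
open import Relation.Nullary.Decidable using (yes; no; ¬?; decidable-stable)
open import Relation.Nullary.Negation using (¬_; contradiction)

-- Lists without repetitions and their lengths.

module _ {A : Set} where

  -- Sending each position of `xs` to a position of the same element in `ys` is injective.
  ⊆⇒length≤ : {xs ys : List A} → Unique xs → xs ⊆ ys → length xs ≤ length ys
  ⊆⇒length≤ {ys = ys} u xs⊆ys = Fin.injective⇒≤ λ {i} {j} eq →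
    lookup-injective u i j
      (trans (lookup-index (xs⊆ys (∈-lookup i)))
        (trans (cong (lookup ys) eq) (sym (lookup-index (xs⊆ys (∈-lookup j))))))

  Unique-resp-↭ : {xs ys : List A} → xs ↭ ys → Unique xs → Unique ys
  Unique-resp-↭ p = Permutationₛ.AllPairs-resp-↭ (setoid A) ≢-sym
    ((λ { refl x≢y → x≢y }) , (λ { refl x≢y → x≢y })) (↭⇒↭ₛ p)

  Unique-++⁻ˡ : ∀ xs {ys : List A} → Unique (xs ++ ys) → Unique xs
  Unique-++⁻ˡ []       _       = []
  Unique-++⁻ˡ (x ∷ xs) (p ∷ u) = All.++⁻ˡ xs p ∷ Unique-++⁻ˡ xs u

  Unique-++⁻ʳ : ∀ xs {ys : List A} → Unique (xs ++ ys) → Unique ys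
  Unique-++⁻ʳ []       u       = u
  Unique-++⁻ʳ (x ∷ xs) (_ ∷ u) = Unique-++⁻ʳ xs u

  ∉⇒Unique-∷ : ∀ {x} {xs : List A} → x ∉ xs → Unique xs → Unique (x ∷ xs)
  ∉⇒Unique-∷ x∉xs u = All.tabulate (λ y∈xs x≡y → x∉xs (subst (_∈ _) (sym x≡y) y∈xs)) ∷ u

  head-≢ : ∀ {x y} {xs : List A} → Unique (x ∷ y ∷ xs) → x ≢ y
  head-≢ ((x≢y ∷ _) ∷ _) = x≢y

  0<length⇒∃∈ : {xs : List A} → 0 < length xs → ∃ (_∈ xs)
  0<length⇒∃∈ {x ∷ _} _ = x , here refl

  ʳ++-++-assoc : ∀ (xs : List A) {ys zs} → (xs ʳ++ ys) ++ zs ≡ xs ʳ++ (ys ++ zs)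
  ʳ++-++-assoc []       = refl
  ʳ++-++-assoc (x ∷ xs) = ʳ++-++-assoc xs


-- Were no element maximal, `f` could be raised again and again; `k` in `go` bounds the room left
-- below `b`.
¬¬-maximum : ∀ {a} {A : Set a} (f : A → ℕ) b → (∀ x → f x ≤ b) → A →
             ¬ ¬ ∃ λ x → ∀ y → f y ≤ f x
¬¬-maximum f b f≤b x₀ none = go b x₀ (m≤n+m b (f x₀))
  where
  go : ∀ k x → b ≤ f x + k → ⊥
  go zero    x b≤ = none (x , λ y → ≤-trans (f≤b y) (subst (b ≤_) (+-identityʳ _) b≤))
  go (suc k) x b≤ = none (x , λ y → ≮⇒≥ λ fx<fy →
    go k y (≤-trans (subst (b ≤_) (+-suc _ k) b≤) (+-monoˡ-≤ k fx<fy)))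

transpose-matchˡ : ∀ {n} (i j : Fin n) → Perm.transpose i j i ≡ j
transpose-matchˡ i j with i Fin.≟ i
... | yes _  = refl
... | no i≢i = contradiction refl i≢i

transpose-injective : ∀ {n} (i j : Fin n) {k l} →
                      Perm.transpose i j k ≡ Perm.transpose i j l → k ≡ l
transpose-injective i j eq =
  trans (sym (Perm.transpose-inverse j i)) (trans (cong (Perm.transpose j i) eq) (Perm.transpose-inverse j i))

module _ (G : Graph) where
  open Graph G
  open DecMembership (Fin._≟_ {order}) using (_∈?_)

  -- Cliques as lists.

  ~⇒≢ : ∀ {u v} → u ~ v → u ≢ v
  ~⇒≢ u~v u≡v = ~-irrefl u≡v u~v

  -- Adjacent vertices differ, so each vertex of a pairwise adjacent list strictly enlarges the set
  -- built from the others.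
  ∃Clique : ∀ xs → AllPairs _~_ xs → ∃ λ k → HasClique G k × length xs ≤ k
  ∃Clique xs c = _ , (set xs , clique c , refl) , size xs c
    where
    set : List Vertex → Subset.Subset order
    set []       = Subset.⊥
    set (x ∷ xs) = set xs Subset.∪ Subset.⁅ x ⁆

    set⁻ : ∀ xs {v} → v Subset.∈ set xs → v ∈ xs
    set⁻ []       v∈ = ⊥-elim (Subset.∉⊥ v∈)
    set⁻ (x ∷ xs) v∈ with Subset.x∈p∪q⁻ (set xs) Subset.⁅ x ⁆ v∈
    ... | inj₁ v∈xs = there (set⁻ xs v∈xs)
    ... | inj₂ v∈x  = here (Subset.x∈⁅y⁆⇒x≡y x v∈x)

    size : ∀ xs → AllPairs _~_ xs → length xs ≤ Subset.∣ set xs ∣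
    size []       []      = z≤n
    size (x ∷ xs) (p ∷ c) = ≤-trans (s≤s (size xs c)) (Subset.p⊂q⇒∣p∣<∣q∣
      ( Subset.p⊆p∪q Subset.⁅ x ⁆
      , x , Subset.q⊆p∪q (set xs) _ (Subset.x∈⁅x⁆ x)
      , λ x∈ → ~-irrefl refl (All.lookup p (set⁻ xs x∈))))

    pairs : ∀ {xs} → AllPairs _~_ xs → ∀ {u v} → u ∈ xs → v ∈ xs → u ≢ v → u ~ v
    pairs (p ∷ c) (here refl) (here refl) u≢v = contradiction refl u≢v
    pairs (p ∷ c) (here refl) (there v∈)  u≢v = All.lookup p v∈
    pairs (p ∷ c) (there u∈)  (here refl) u≢v = ~-sym (All.lookup p u∈)
    pairs (p ∷ c) (there u∈)  (there v∈)  u≢v = pairs c u∈ v∈ u≢v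

    clique : ∀ {xs} → AllPairs _~_ xs → IsClique G (set xs)
    clique {xs} c u v u∈ v∈ = pairs c (set⁻ xs u∈) (set⁻ xs v∈)

  -- The non-edge is brought to the front by a permutation, so that the other vertices `ys` stay at
  -- hand for a second search.
  clique-or-nonedge : ∀ xs → AllPairs _~_ xs ⊎
    ∃ λ a → ∃ λ b → ∃ λ ys → xs ↭ a ∷ b ∷ ys × ¬ a ~ b
  clique-or-nonedge [] = inj₁ []
  clique-or-nonedge (x ∷ xs) with all? (x ~?_) xs
  ... | no ¬all with b , b∈xs , x≁b ← find (¬All⇒Any¬ (x ~?_) xs ¬all)
                with ys , zs , refl ← ∈-∃++ b∈xs
    = inj₂ (x , b , ys ++ zs , prep x (shift b ys zs) , x≁b)
  ... | yes all with clique-or-nonedge xs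
  ...   | inj₁ c = inj₁ (all ∷ c)
  ...   | inj₂ (a , b , ys , p , a≁b) = inj₂ (a , b , x ∷ ys ,
          ↭-trans (prep x p) (↭-trans (swap x a ↭-refl) (prep a (swap x b ↭-refl))) , a≁b)

  -- Cutting, splicing and reversing walks.

  linked-++⁻ʳ : ∀ xs {ys} → Linked _~_ (xs ++ ys) → Linked _~_ ys
  linked-++⁻ʳ []       l = l
  linked-++⁻ʳ (x ∷ xs) l = linked-++⁻ʳ xs (Linked.tail l)

  linked-replaceʳ : ∀ xs {y ys zs} → Linked _~_ (xs ++ y ∷ ys) → Linked _~_ (y ∷ zs) →
                    Linked _~_ (xs ++ y ∷ zs)
  linked-replaceʳ []            _       l′ = l′
  linked-replaceʳ (x ∷ [])      (r ∷ _) l′ = r ∷ l′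
  linked-replaceʳ (x ∷ x′ ∷ xs) (r ∷ l) l′ = r ∷ linked-replaceʳ (x′ ∷ xs) l l′

  -- The core of a rotation: the segment from `v` to `u` is walked backwards and left at `v` towards
  -- `zs`.
  linked-ʳ++ : ∀ v xs u {ys zs} → Linked _~_ (v ∷ xs ++ u ∷ ys) → Linked _~_ (v ∷ zs) →
               Linked _~_ (u ∷ xs ʳ++ (v ∷ zs))
  linked-ʳ++ v []       u (r ∷ _) l′ = ~-sym r ∷ l′
  linked-ʳ++ v (x ∷ xs) u (r ∷ l) l′ = linked-ʳ++ x xs u l (~-sym r ∷ l′)

  -- Colourings of vertex lists.

  Colours : ℕ → List Vertex → Set
  Colours d S = ∃ λ (f : Vertex → Fin d) → ∀ {u v} → u ∈ S → v ∈ S → u ~ v → f u ≢ f v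

  module _ {d} (0<d : 0 < d) where

    -- Vertices outside ps get the junk colour 0.
    position : ∀ ps → length ps ≤ d → Vertex → Fin d
    position ps ps≤d v with v ∈? ps
    ... | yes v∈ps = inject≤ (index v∈ps) ps≤d
    ... | no  _    = fromℕ< 0<d

    position-injective : ∀ ps ps≤d {u v} → u ∈ ps → v ∈ ps →
                         position ps ps≤d u ≡ position ps ps≤d v → u ≡ v
    position-injective ps ps≤d {u} {v} u∈ v∈ eq with u ∈? ps | v ∈? ps
    ... | no u∉  | _      = contradiction u∈ u∉
    ... | yes _  | no v∉  = contradiction v∈ v∉
    ... | yes u∈′ | yes v∈′ = trans (lookup-index u∈′)
            (trans (cong (lookup ps) (Fin.inject≤-injective ps≤d ps≤d _ _ eq)) (sym (lookup-index v∈′)))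

    -- Positions in `ps` serve as colours; vertices with the same representative share one.
    colour-by-representatives : ∀ S ps (r : Vertex → Vertex) → length ps ≤ d →
      (∀ {v} → v ∈ S → r v ∈ ps) → (∀ {u v} → u ~ v → r u ≢ r v) → Colours d S
    colour-by-representatives S ps r ps≤d r∈ r≢ =
      position ps ps≤d ∘ r , λ u∈ v∈ u~v eq → r≢ u~v (position-injective ps ps≤d (r∈ u∈) (r∈ v∈) eq)

    -- Giving `b` the colour of `a`, and `e` that of `c`, saves two colours: `c ∷ ps` has two
    -- entries fewer than `S`, hence at most `d`.
    colour-two-nonedges : ∀ {S a b c e} ps → S ↭ b ∷ c ∷ e ∷ ps → ¬ a ~ b → ¬ c ~ e →
      a ∈ ps → a ≢ c → a ≢ e → b ≢ c → length S ≤ 2 + d → Colours d S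
    colour-two-nonedges {S} {a} {b} {c} {e} ps p a≁b c≁e a∈ps a≢c a≢e b≢c S≤ =
      colour-by-representatives S (c ∷ ps) r (≤-pred (≤-pred (subst (_≤ 2 + d) (↭-length p) S≤)))
        (r∈ ∘ ∈-resp-↭ p) r≢
      where
      r : Vertex → Vertex
      r v with v Fin.≟ b | v Fin.≟ e
      ... | yes _ | _     = a
      ... | no _  | yes _ = c
      ... | no _  | no _  = v

      r∈ : ∀ {v} → v ∈ b ∷ c ∷ e ∷ ps → r v ∈ c ∷ ps
      r∈ {v} v∈ with v Fin.≟ b | v Fin.≟ e | v∈
      ... | yes _  | _      | _                        = there a∈ps
      ... | no _   | yes _  | _                        = here refl
      ... | no v≢b | _      | here v≡b                 = contradiction v≡b v≢b
      ... | no _   | no _   | there (here v≡c)         = here v≡c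
      ... | no _   | no v≢e | there (there (here v≡e)) = contradiction v≡e v≢e
      ... | no _   | no _   | there (there (there v∈ps)) = there v∈ps

      r≢ : ∀ {u v} → u ~ v → r u ≢ r v
      r≢ {u} {v} u~v with u Fin.≟ b | u Fin.≟ e | v Fin.≟ b | v Fin.≟ e
      ... | yes refl | _        | yes refl | _        = λ _ → ~-irrefl refl u~v
      ... | yes refl | _        | no _     | yes refl = a≢c
      ... | yes refl | _        | no _     | no _     = λ { refl → a≁b (~-sym u~v) }
      ... | no _     | yes refl | yes refl | _        = a≢c ∘ sym
      ... | no _     | yes refl | no _     | yes refl = λ _ → ~-irrefl refl u~v
      ... | no _     | yes refl | no _     | no _     = λ { refl → c≁e (~-sym u~v) }
      ... | no _     | no _     | yes refl | _        = λ { refl → a≁b u~v }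
      ... | no _     | no _     | no _     | yes refl = λ { refl → c≁e u~v }
      ... | no _     | no _     | no _     | no _     = ~⇒≢ u~v

  -- Deleting vertices and extending colourings.

  _─_ : List Vertex → List Vertex → List Vertex
  S ─ K = filter (λ v → ¬? (v ∈? K)) S

  ─-shorter : ∀ {S K v} → v ∈ S → v ∈ K → length (S ─ K) < length S
  ─-shorter {S} {K} v∈S v∈K = filter-notAll (λ v → ¬? (v ∈? K)) S
    (Any.map (λ { refl v∉K → v∉K v∈K }) v∈S)

  ─-unique : ∀ {S} K → Unique S → Unique (S ─ K)
  ─-unique K = Unique.filter⁺ (λ v → ¬? (v ∈? K))

  -- A colouring of x ∷ K is recoloured so that x matches the rest.
  colour-glue : ∀ {d S K x} → x ∈ S → x ∉ K →
    (∀ {u z} → u ∈ K → z ∈ S → u ~ z → z ∈ x ∷ K) →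
    Colours d (x ∷ K) → Colours d (S ─ K) → Colours d S
  colour-glue {d} {S} {K} {x} x∈S x∉K closed (g , g≢) (f , f≢) = h , h≢
    where
    π : Fin d → Fin d
    π = Perm.transpose (g x) (f x)

    h : Vertex → Fin d
    h v with v ∈? K
    ... | yes _ = π (g v)
    ... | no  _ = f v

    across : ∀ {u v} → u ∈ K → v ∉ K → v ∈ S → u ~ v → π (g u) ≢ f v
    across u∈K v∉K v∈S u~v with closed u∈K v∈S u~v
    ... | there v∈K = contradiction v∈K v∉K
    ... | here refl = λ eq → g≢ (there u∈K) (here refl) u~v
            (transpose-injective (g x) (f x) (trans eq (sym (transpose-matchˡ (g x) (f x)))))

    h≢ : ∀ {u v} → u ∈ S → v ∈ S → u ~ v → h u ≢ h v
    h≢ {u} {v} u∈S v∈S u~v with u ∈? K | v ∈? K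
    ... | yes u∈K | yes v∈K = g≢ (there u∈K) (there v∈K) u~v ∘ transpose-injective (g x) (f x)
    ... | yes u∈K | no v∉K  = across u∈K v∉K v∈S u~v
    ... | no u∉K  | yes v∈K = across v∈K u∉K u∈S (~-sym u~v) ∘ sym
    ... | no u∉K  | no v∉K  = f≢ (∈-filter⁺ _ u∈S u∉K) (∈-filter⁺ _ v∈S v∉K) u~v

  -- Fewer than `d` neighbours cannot use up all `d` colours, so one is free for `v`.
  colour-extend : ∀ {d S v} → v ∈ S → length (filter (v ~?_) S) < d →
                  Colours d (S ─ [ v ]) → Colours d S
  colour-extend {d} {S} {v} v∈S deg<d (f , f≢) = h , h≢
    where
    open DecMembership (Fin._≟_ {d}) using () renaming (_∈?_ to _∈ᶜ?_)

    used : List (Fin d)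
    used = map f (filter (v ~?_) S)

    free : ∃ λ c → c ∉ used
    free = Fin.¬∀⟶∃¬ d (_∈ used) (_∈ᶜ? used) λ all →
      <-irrefl refl (≤-trans (subst (_≤ d) (cong suc (sym (length-map f (filter (v ~?_) S)))) deg<d)
        (subst (_≤ length used) (length-tabulate {n = d} (λ i → i))
          (⊆⇒length≤ (Unique.allFin⁺ d) (λ {c} _ → all c))))

    h : Vertex → Fin d
    h u with u Fin.≟ v
    ... | yes _ = proj₁ free
    ... | no  _ = f u

    fresh : ∀ {u} → u ∈ S → v ~ u → proj₁ free ≢ f u
    fresh u∈S v~u eq = proj₂ free (subst (_∈ used) (sym eq) (∈-map⁺ f (∈-filter⁺ (v ~?_) u∈S v~u)))

    old : ∀ {u} → u ∈ S → u ≢ v → u ∈ S ─ [ v ]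
    old u∈S u≢v = ∈-filter⁺ _ u∈S λ { (here u≡v) → u≢v u≡v }

    h≢ : ∀ {u w} → u ∈ S → w ∈ S → u ~ w → h u ≢ h w
    h≢ {u} {w} u∈S w∈S u~w with u Fin.≟ v | w Fin.≟ v
    ... | yes refl | yes refl = λ _ → ~-irrefl refl u~w
    ... | yes refl | no _     = fresh w∈S u~w
    ... | no _     | yes refl = fresh u∈S (~-sym u~w) ∘ sym
    ... | no u≢v   | no w≢v   = f≢ (old u∈S u≢v) (old w∈S w≢v) u~w

  -- Pósa rotations.

  EndOf : List Vertex → Vertex → List Vertex → Vertex → Set
  EndOf K x Q u = ∃ λ T → u ∷ T ↭ K × Linked _~_ (u ∷ T ++ x ∷ Q)

  rotation-↭ : ∀ (v : Vertex) A u B → u ∷ A ʳ++ (v ∷ B) ↭ v ∷ A ++ u ∷ B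
  rotation-↭ v A u B =
    ↭-trans (prep u (↭-trans (↭-sym (++↭ʳ++ A (v ∷ B))) (shift v A B)))
      (↭-trans (swap u v ↭-refl) (prep v (↭-sym (shift u A B))))

  -- A rotation joins `v` to what follows `u`, drops the step out of `u` and reverses the segment
  -- between them. Everything from `x` on stays in place.
  rotate : ∀ v A u B {x Q} → Linked _~_ ((v ∷ A ++ u ∷ B) ++ x ∷ Q) → Linked _~_ (v ∷ B ++ x ∷ Q) →
           EndOf (v ∷ A ++ u ∷ B) x Q u
  rotate v A u B {x} {Q} l l′ =
    A ʳ++ (v ∷ B) , rotation-↭ v A u B ,
    subst (Linked _~_) (cong (u ∷_) (sym (ʳ++-++-assoc A)))
      (linked-ʳ++ v A u (subst (Linked _~_) (++-assoc (v ∷ A) (u ∷ B) (x ∷ Q)) l) l′)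

  -- Paths, lassos and lobes.

  record Path (S xs : List Vertex) : Set where
    field
      distinct : Unique xs
      linked   : Linked _~_ xs
      inside   : All (_∈ S) xs

  Enclosed : List Vertex → List Vertex → Vertex → Set
  Enclosed S C u = ∀ {z} → z ∈ S → u ~ z → z ∈ C

  -- The vertex `x` is the only way out of `v ∷ T`, the part deleted in the induction; `x` itself is
  -- kept and may have neighbours elsewhere in `S`.
  record Lobe (S : List Vertex) (m : ℕ) : Set where
    field
      v x      : Vertex
      T        : List Vertex
      distinct : Unique (x ∷ v ∷ T)
      inside   : All (_∈ S) (x ∷ v ∷ T)
      enclosed : ∀ {u} → u ∈ v ∷ T → Enclosed S (x ∷ v ∷ T) u
      small    : length (x ∷ v ∷ T) ≤ m

  -- A loop `v ∷ T` closed by `x`, with tail `Q`. In its uses `n` is the length of a longest path,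
  -- so only the length of `T` is left to maximise.
  record Lasso (S : List Vertex) (n : ℕ) : Set where
    field
      v x    : Vertex
      T Q    : List Vertex
      path   : Path S ((v ∷ T) ++ x ∷ Q)
      size   : length ((v ∷ T) ++ x ∷ Q) ≡ n
      closes : v ~ x

  -- Non-neighbours under minimum degree `d`.

  module _ {d S} (uS : Unique S) (deg : ∀ {v} → v ∈ S → d ≤ length (filter (v ~?_) S)) where

    -- The neighbours of `u`, at least `d` in number, all lie in `C` and are disjoint from `F`.
    nonneighbours-bound : ∀ {u C F} → u ∈ S → Enclosed S C u → Unique F → F ⊆ C →
      All (λ f → ¬ u ~ f) F → length F + d ≤ length C
    nonneighbours-bound {u} {C} {F} u∈S enc uF F⊆C u≁F = begin
      length F + d        ≤⟨ +-monoʳ-≤ (length F) (deg u∈S) ⟩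
      length F + length N ≡⟨ length-++ F ⟨
      length (F ++ N)     ≤⟨ ⊆⇒length≤ (Unique.++⁺ uF (Unique.filter⁺ (u ~?_) uS) disjoint) F++N⊆C ⟩
      length C            ∎
      where
      open ≤-Reasoning
      N = filter (u ~?_) S

      disjoint : ∀ {z} → ¬ (z ∈ F × z ∈ N)
      disjoint (z∈F , z∈N) = All.lookup u≁F z∈F (proj₂ (∈-filter⁻ (u ~?_) {xs = S} z∈N))

      F++N⊆C : F ++ N ⊆ C
      F++N⊆C z∈ with ∈-++⁻ F z∈
      ... | inj₁ z∈F = F⊆C z∈F
      ... | inj₂ z∈N with z∈S , u~z ← ∈-filter⁻ (u ~?_) {xs = S} z∈N = enc z∈S u~z

    module _ {u C} (u∈S : u ∈ S) (enc : Enclosed S C u) (u∈C : u ∈ C) where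

      enclosed⇒large : 1 + d ≤ length C
      enclosed⇒large = nonneighbours-bound u∈S enc ([] ∷ []) (λ { (here refl) → u∈C })
        (~-irrefl refl ∷ [])

      nonneighbour⇒larger : ∀ {w} → w ∈ C → w ≢ u → ¬ u ~ w → 2 + d ≤ length C
      nonneighbour⇒larger w∈C w≢u u≁w = nonneighbours-bound u∈S enc ((w≢u ∷ []) ∷ [] ∷ [])
        (λ { (here refl) → w∈C ; (there (here refl)) → u∈C }) (u≁w ∷ ~-irrefl refl ∷ [])

      -- Three non-neighbours `c`, `w` and `u` itself would force `3 + d` vertices into `C`.
      other-neighbour : length C ≤ 2 + d → ∀ {w c} → w ∈ C → w ≢ u → ¬ u ~ w →
        c ∈ C → c ≢ u → c ≢ w → u ~ c
      other-neighbour C≤ {w} {c} w∈C w≢u u≁w c∈C c≢u c≢w = decidable-stable (u ~? c) λ u≁c →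
        <-irrefl refl (≤-trans
          (nonneighbours-bound u∈S enc ((c≢w ∷ c≢u ∷ []) ∷ (w≢u ∷ []) ∷ [] ∷ [])
            (λ { (here refl) → c∈C ; (there (here refl)) → w∈C ; (there (there (here refl))) → u∈C })
            (u≁c ∷ u≁w ∷ ~-irrefl refl ∷ []))
          C≤)

    -- Ends of an optimal lasso.

    module _ {n} (longest : ∀ {xs} → Path S xs → length xs ≤ n) (l : Lasso S n)
             (maximal : ∀ (l′ : Lasso S n) → length (Lasso.T l′) ≤ length (Lasso.T l)) where
      open Lasso l
      open Path path

      -- A neighbour off the path would lengthen a longest path; one beyond `x` would close a lasso
      -- with a longer loop.
      end⇒enclosed : ∀ {u} → EndOf (v ∷ T) x Q u → Enclosed S (x ∷ v ∷ T) u
      end⇒enclosed {u} (T′ , p , lk) {z} z∈S u~z with z ∈? (u ∷ T′) ++ x ∷ Q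
      ... | no z∉ = contradiction
              (longest {z ∷ (u ∷ T′) ++ x ∷ Q} record
                { distinct = ∉⇒Unique-∷ z∉ (Unique-resp-↭ q distinct)
                ; linked   = ~-sym u~z ∷ lk
                ; inside   = z∈S ∷ All-resp-↭ q inside })
              (<⇒≱ (≤-reflexive (cong suc (trans (sym size) (↭-length q)))))
        where q = ↭-++⁺ʳ (x ∷ Q) (↭-sym p)
      ... | yes z∈ with ∈-++⁻ (u ∷ T′) z∈
      ...   | inj₁ z∈K           = there (∈-resp-↭ p z∈K)
      ...   | inj₂ (here z≡x)    = here z≡x
      ...   | inj₂ (there z∈Q) with Q₁ , Q₂ , refl ← ∈-∃++ z∈Q =
              contradiction (maximal longer) (<⇒≱ (begin-strict
                length T                 ≡⟨ suc-injective (↭-length p) ⟨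
                length T′                <⟨ m<m+n (length T′) (s≤s z≤n) ⟩
                length T′ + suc (length Q₁) ≡⟨ length-++ T′ ⟨
                length (T′ ++ x ∷ Q₁)    ∎))
        where
        open ≤-Reasoning
        q = ↭-++⁺ʳ (x ∷ Q₁ ++ z ∷ Q₂) (↭-sym p)
        assoc = ++-assoc (u ∷ T′) (x ∷ Q₁) (z ∷ Q₂)

        longer : Lasso S n
        longer = record
          { v = u ; x = z ; T = T′ ++ x ∷ Q₁ ; Q = Q₂
          ; path = subst (Path S) (sym assoc) record
              { distinct = Unique-resp-↭ q distinct
              ; linked   = lk
              ; inside   = All-resp-↭ q inside }
          ; size = trans (cong length assoc) (trans (sym (↭-length q)) size)
          ; closes = u~z }

    -- If `v` is adjacent to the successor of `u`, which is `x` when `B` is empty, one rotation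
    -- suffices. Otherwise that successor `w` is the only vertex of `x ∷ K` besides `v` that `v`
    -- misses, and this near-completeness allows a detour.
    all-ends : 4 ≤ d → ∀ {v x Q} A u B → let K = v ∷ A ++ u ∷ B in
      Path S (K ++ x ∷ Q) → v ~ x → length (x ∷ K) ≤ 2 + d →
      (∀ {u} → EndOf K x Q u → Enclosed S (x ∷ K) u) → EndOf K x Q u
    all-ends 4≤d {v} {x} {Q} A u [] P v~x K≤ enc =
      rotate v A u [] linked (v~x ∷ linked-++⁻ʳ (v ∷ A ++ [ u ]) linked)
      where open Path P
    all-ends 4≤d {v} {x} {Q} A u (w ∷ B) P v~x K≤ enc = by-adjacency (v ~? w)
      where
      open Path P
      K = v ∷ A ++ u ∷ w ∷ B
      C = x ∷ K

      tail-linked : Linked _~_ (u ∷ w ∷ B ++ x ∷ Q)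
      tail-linked = linked-++⁻ʳ (v ∷ A) (subst (Linked _~_) (++-assoc (v ∷ A) (u ∷ w ∷ B) (x ∷ Q)) linked)

      tail-distinct : Unique (u ∷ w ∷ B ++ x ∷ Q)
      tail-distinct = Unique-++⁻ʳ (v ∷ A) (subst Unique (++-assoc (v ∷ A) (u ∷ w ∷ B) (x ∷ Q)) distinct)

      u∈T : u ∈ A ++ u ∷ w ∷ B
      u∈T = ∈-++⁺ʳ A (here refl)

      w∈T : w ∈ A ++ u ∷ w ∷ B
      w∈T = ∈-++⁺ʳ A (there (here refl))

      B⊆T : B ⊆ A ++ u ∷ w ∷ B
      B⊆T b∈B = ∈-++⁺ʳ A (there (there b∈B))

      ∈K⇒∈S : ∀ {z} → z ∈ K → z ∈ S
      ∈K⇒∈S z∈K = All.lookup inside (∈-++⁺ˡ z∈K)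

      ≢v : ∀ {z} → z ∈ A ++ u ∷ w ∷ B → z ≢ v
      ≢v z∈ with p ∷ _ ← distinct = ≢-sym (All.lookup p (∈-++⁺ˡ z∈))

      B≢w : ∀ {z} → z ∈ B → z ≢ w
      B≢w z∈ with _ ∷ p ∷ _ ← tail-distinct = ≢-sym (All.lookup p (∈-++⁺ˡ z∈))

      by-adjacency : _ → EndOf K x Q u
      by-adjacency (yes v~w) = rotate v A u (w ∷ B) linked (v~w ∷ Linked.tail tail-linked)
      -- Both v and w are adjacent to all other vertices of C, so K can be rerouted to start at u.
      by-adjacency (no v≁w) = reroute A B refl refl
        where
        v~ : ∀ {c} → c ∈ C → c ≢ v → c ≢ w → v ~ c
        v~ = other-neighbour (∈K⇒∈S (here refl)) (enc (A ++ u ∷ w ∷ B , ↭-refl , linked)) (there (here refl))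
          K≤ (there (there w∈T)) (≢v w∈T) v≁w

        -- From `v` the path can be entered at any vertex of `B`, or at `x` when nothing of `B` is
        -- left.
        skip : ∀ B′ → B′ ⊆ B → Linked _~_ (B′ ++ x ∷ Q) → Linked _~_ (v ∷ B′ ++ x ∷ Q)
        skip []       _    l = v~x ∷ l
        skip (b ∷ B′) B′⊆B l = v~ (there (there (B⊆T b∈B))) (≢v (B⊆T b∈B)) (B≢w b∈B) ∷ l
          where b∈B = B′⊆B (here refl)

        -- As `v` is adjacent to the successor of `w`, a rotation makes `w` an end; so `w` is
        -- enclosed too and misses only `v`.
        w-end : EndOf K x Q w
        w-end = subst (λ T → EndOf (v ∷ T) x Q w) assoc
          (rotate v (A ++ [ u ]) w B (subst (λ T → Linked _~_ (v ∷ T ++ x ∷ Q)) (sym assoc) linked)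
            (skip B (λ b∈B → b∈B) (Linked.tail (Linked.tail tail-linked))))
          where assoc = ++-assoc A [ u ] (w ∷ B)

        w~ : ∀ {c} → c ∈ C → c ≢ w → c ≢ v → w ~ c
        w~ = other-neighbour (∈K⇒∈S (there w∈T)) (enc w-end) (there (there w∈T))
          K≤ (there (here refl)) (≢-sym (≢v w∈T)) (v≁w ∘ ~-sym)

        -- The non-edge between `v` and `w` gives `2 + d` vertices in `C`. With `d` at least 4, `B`
        -- has two or more vertices when `A` is empty.
        6≤C : 6 ≤ length C
        6≤C = ≤-trans (s≤s (s≤s 4≤d))
          (nonneighbour⇒larger (∈K⇒∈S (here refl)) (enc (A ++ u ∷ w ∷ B , ↭-refl , linked))
            (there (here refl)) (there (there w∈T)) (≢v w∈T) v≁w)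

        reroute : ∀ A′ B′ → A′ ≡ A → B′ ≡ B → EndOf K x Q u
        -- With `A` empty, `v` moves between its neighbours `b` and `b′`.
        reroute [] (b ∷ b′ ∷ B′) refl refl =
          w ∷ b ∷ v ∷ b′ ∷ B′ , shift v (u ∷ w ∷ b ∷ []) (b′ ∷ B′) , rerouted tail-linked
          where
          rerouted : Linked _~_ (u ∷ w ∷ b ∷ b′ ∷ B′ ++ x ∷ Q) → Linked _~_ (u ∷ w ∷ b ∷ v ∷ b′ ∷ B′ ++ x ∷ Q)
          rerouted (u~w ∷ w~b ∷ b~b′ ∷ l) =
            u~w ∷ w~b ∷ ~-sym (Linked.head (skip (b ∷ b′ ∷ B′) (λ z → z) (b~b′ ∷ l))) ∷ skip (b′ ∷ B′) there l
        reroute [] []       refl refl with s≤s (s≤s (s≤s (s≤s ()))) ← 6≤C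
        reroute [] (b ∷ []) refl refl with s≤s (s≤s (s≤s (s≤s (s≤s ())))) ← 6≤C
        -- The new path runs from `u` back through `A′` to `v`, then over `a` to `w`, which is
        -- adjacent to `a`.
        reroute (a ∷ A′) B′ refl refl with distinct | linked
        ... | _ ∷ a≢ ∷ u′ | v~a ∷ l =
          A′ ʳ++ (v ∷ a ∷ w ∷ B) ,
          ↭-trans (rotation-↭ v A′ u (a ∷ w ∷ B))
            (prep v (↭-trans (↭-++⁺ˡ A′ (swap u a ↭-refl)) (shift a A′ (u ∷ w ∷ B)))) ,
          subst (Linked _~_) (cong (u ∷_) (sym (ʳ++-++-assoc A′)))
            (linked-ʳ++ v A′ u
              (first A′ refl (subst (Linked _~_) (++-assoc A′ (u ∷ w ∷ B) (x ∷ Q)) (Linked.tail l)))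
              (v~a ∷ ~-sym (w~ (there (there (here refl))) a≢w (≢v (here refl))) ∷ Linked.tail tail-linked))
          where
          a≢w : a ≢ w
          a≢w = All.lookup a≢ (∈-++⁺ˡ (∈-++⁺ʳ A′ (there (here refl))))

          -- Now `v` jumps over `a` to the next vertex of `A′`, or to `u` if there is none.
          first : ∀ A″ → A″ ≡ A′ → Linked _~_ (A″ ++ u ∷ w ∷ B ++ x ∷ Q) →
                  Linked _~_ (v ∷ A″ ++ u ∷ w ∷ B ++ x ∷ Q)
          first [] refl l′ = v~ (there (there u∈T)) (≢v u∈T) (~⇒≢ (Linked.head tail-linked)) ∷ l′
          first (c ∷ A″) refl l′ =
            v~ (there (there (there (here refl)))) (≢v (there (here refl)))
              (All.lookup (AllPairs.head u′) (∈-++⁺ˡ (∈-++⁺ʳ A″ (there (here refl))))) ∷ l′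

    -- From a longest path to a lobe.

    lasso : 0 < d → ∀ {v R} → Path S (v ∷ R) → (∀ {xs} → Path S xs → length xs ≤ length (v ∷ R)) →
            Lasso S (length (v ∷ R))
    lasso 0<d {v} {R} P longest
      with z , z∈N ← 0<length⇒∃∈ (≤-trans 0<d (deg (All.head (Path.inside P))))
      with z∈S , v~z ← ∈-filter⁻ (v ~?_) {xs = S} z∈N
      with z ∈? v ∷ R
    ... | no z∉ = contradiction
            (longest {z ∷ v ∷ R} record
              { distinct = ∉⇒Unique-∷ z∉ (Path.distinct P)
              ; linked   = ~-sym v~z ∷ Path.linked P
              ; inside   = z∈S ∷ Path.inside P })
            (<⇒≱ ≤-refl)
    ... | yes (here refl) = contradiction v~z (~-irrefl refl)
    ... | yes (there z∈R) with A , Q , refl ← ∈-∃++ z∈R =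
      record { v = v ; x = z ; T = A ; Q = Q ; path = P ; size = refl ; closes = v~z }

    -- The loop and `x` form a cycle, so they have at most `2 + d` vertices. This bound lets every
    -- vertex of the loop become an end, hence be enclosed.
    lasso⇒lobe : 4 ≤ d → (∀ {m} → HasCycle G m → m ≤ 2 + d) →
      ∀ {n} → (∀ {xs} → Path S xs → length xs ≤ n) → (l : Lasso S n) →
      (∀ (l′ : Lasso S n) → length (Lasso.T l′) ≤ length (Lasso.T l)) → Lobe S (2 + d)
    lasso⇒lobe 4≤d short longest l maximal = record
      { v = v ; x = x ; T = T
      ; distinct = Unique-++⁻ˡ (x ∷ v ∷ T) (Unique-resp-↭ (shift x (v ∷ T) Q) distinct)
      ; inside   = All.++⁻ˡ (x ∷ v ∷ T) (All-resp-↭ (shift x (v ∷ T) Q) inside)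
      ; enclosed = λ u∈K → enclosed (end u∈K)
      ; small    = small }
      where
      open Lasso l
      open Path path

      enclosed : ∀ {u} → EndOf (v ∷ T) x Q u → Enclosed S (x ∷ v ∷ T) u
      enclosed = end⇒enclosed longest l maximal

      C↭cycle : x ∷ v ∷ T ↭ v ∷ T ++ [ x ]
      C↭cycle = ∷↭∷ʳ x (v ∷ T)

      cycle : IsCycle G (v ∷ T ++ [ x ])
      cycle = isCycle
        (≤-trans (≤-trans (m≤n+m 3 2) (s≤s 4≤d)) (subst (1 + d ≤_) (↭-length C↭cycle)
          (enclosed⇒large (All.head inside) (enclosed (T , ↭-refl , linked)) (there (here refl)))))
        (Unique-resp-↭ C↭cycle (Unique-++⁻ˡ (x ∷ v ∷ T) (Unique-resp-↭ (shift x (v ∷ T) Q) distinct)))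
        (subst (Linked _~_) (sym (++-assoc (v ∷ T) [ x ] [ v ]))
          (linked-replaceʳ (v ∷ T) linked (~-sym closes ∷ [-])))

      small : length (x ∷ v ∷ T) ≤ 2 + d
      small = subst (_≤ 2 + d) (sym (↭-length C↭cycle)) (short (_ , cycle , refl))

      end : ∀ {u} → u ∈ v ∷ T → EndOf (v ∷ T) x Q u
      end (here refl) = T , ↭-refl , linked
      end {u} (there u∈T) = end-of-split (∈-∃++ u∈T)
        where
        end-of-split : (∃ λ A → ∃ λ B → T ≡ A ++ [ u ] ++ B) → EndOf (v ∷ T) x Q u
        end-of-split (A , B , T≡) = subst (λ T → EndOf (v ∷ T) x Q u) (sym T≡)
          (all-ends 4≤d A u B (subst (λ T → Path S (v ∷ T ++ x ∷ Q)) T≡ path) closes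
            (subst (λ T → length (x ∷ v ∷ T) ≤ 2 + d) T≡ small)
            (subst (λ T → ∀ {u} → EndOf (v ∷ T) x Q u → Enclosed S (x ∷ v ∷ T) u) T≡ enclosed))

    -- Two maximisations in turn: a longest path, then a longest `T` among the lassos of that size.
    ¬¬-lobe : 4 ≤ d → (∀ {m} → HasCycle G m → m ≤ 2 + d) → ∀ {s} → s ∈ S → ¬ ¬ Lobe S (2 + d)
    ¬¬-lobe 4≤d short {s} s∈S none =
      ¬¬-maximum (length ∘ proj₁) (length S) path≤S trivial λ where
        ((xs , P) , longest) → from-longest xs P λ {ys} Q → longest (ys , Q)
      where
      path≤S : ∀ ((xs , _) : ∃ (Path S)) → length xs ≤ length S
      path≤S (_ , P) = ⊆⇒length≤ (Path.distinct P) (All.lookup (Path.inside P))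

      trivial : ∃ (Path S)
      trivial = [ s ] , record { distinct = [] ∷ [] ; linked = [-] ; inside = s∈S ∷ [] }

      T≤n : ∀ {n} (l : Lasso S n) → length (Lasso.T l) ≤ n
      T≤n l = ≤-trans (n≤1+n _) (≤-trans (m≤m+n _ _)
        (≤-reflexive (trans (sym (length-++ (Lasso.v l ∷ Lasso.T l))) (Lasso.size l))))

      from-longest : ∀ xs → Path S xs → (∀ {ys} → Path S ys → length ys ≤ length xs) → ⊥
      from-longest [] _ longest with () ← longest (proj₂ trivial)
      from-longest (v ∷ R) P longest =
        ¬¬-maximum (length ∘ Lasso.T) _ T≤n (lasso (≤-trans (s≤s z≤n) 4≤d) P longest) λ where
          (l , maximal) → none (lasso⇒lobe 4≤d short longest l maximal)

    -- `C` is too large for a clique, and a non-edge in it forces more than `d` vertices into `K`.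
    -- So `K` contains a non-edge `a`, `b`, and `C` without `b` contains another; merging both pairs
    -- saves two colours.
    colour-lobe : 0 < d → (∀ xs → AllPairs _~_ xs → length xs ≤ d) → (l : Lobe S (2 + d)) →
      let open Lobe l in Colours d (x ∷ v ∷ T)
    colour-lobe 0<d no-clique l = colour (clique-or-nonedge C)
      where
      open Lobe l
      K = v ∷ T
      C = x ∷ K

      ∈S : ∀ {u} → u ∈ C → u ∈ S
      ∈S = All.lookup inside

      K-large : ∀ {u w} → u ∈ K → w ∈ C → w ≢ u → ¬ u ~ w → 1 + d ≤ length K
      K-large u∈K w∈C w≢u u≁w = ≤-pred
        (nonneighbour⇒larger (∈S (there u∈K)) (enclosed u∈K) (there u∈K) w∈C w≢u u≁w)

      -- The degree count applies to vertices of `K`; of two distinct vertices of `C` at least one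
      -- lies there.
      nonedge-K-large : ∀ {a b} → a ∈ C → b ∈ C → a ≢ b → ¬ a ~ b → 1 + d ≤ length K
      nonedge-K-large (there a∈K) b∈C             a≢b a≁b = K-large a∈K b∈C (≢-sym a≢b) a≁b
      nonedge-K-large a∈C@(here _) (there b∈K)    a≢b a≁b = K-large b∈K a∈C a≢b (a≁b ∘ ~-sym)
      nonedge-K-large (here refl)  (here refl)    a≢b a≁b = contradiction refl a≢b

      with-two-nonedges : ∀ {a b ys c e zs} → K ↭ a ∷ b ∷ ys → ¬ a ~ b →
        x ∷ a ∷ ys ↭ c ∷ e ∷ zs → ¬ c ~ e → Colours d C
      with-two-nonedges {a} {b} {ys} {c} {e} {zs} p a≁b q c≁e =
        by-position (Unique-resp-↭ C↭ distinct) (∈-resp-↭ q (there (here refl)))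
        where
        C↭ : C ↭ b ∷ c ∷ e ∷ zs
        C↭ = ↭-trans (prep x (↭-trans p (swap a b ↭-refl))) (↭-trans (swap x b ↭-refl) (prep b q))

        ∈C : ∀ {z} → z ∈ b ∷ c ∷ e ∷ zs → z ∈ C
        ∈C = ∈-resp-↭ (↭-sym C↭)

        a∈K : a ∈ K
        a∈K = ∈-resp-↭ (↭-sym p) (here refl)

        a~ : ∀ {z} → z ∈ C → z ≢ a → z ≢ b → a ~ z
        a~ = other-neighbour (∈S (there a∈K)) (enclosed a∈K) (there a∈K) small (∈C (here refl))
          (≢-sym (head-≢ (Unique-resp-↭ p (AllPairs.tail distinct)))) a≁b

        -- Apart from itself `a` misses only `b`, so it is neither `c` nor `e`, and the two pairs
        -- are disjoint.
        by-position : Unique (b ∷ c ∷ e ∷ zs) → a ∈ c ∷ e ∷ zs → Colours d C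
        by-position ((_ ∷ b≢e ∷ _) ∷ (c≢e ∷ _) ∷ _) (here refl) =
          contradiction (a~ (∈C (there (there (here refl)))) (≢-sym c≢e) (≢-sym b≢e)) c≁e
        by-position ((b≢c ∷ _) ∷ (c≢e ∷ _) ∷ _) (there (here refl)) =
          contradiction (~-sym (a~ (∈C (there (here refl))) c≢e (≢-sym b≢c))) c≁e
        by-position ((b≢c ∷ _) ∷ (_ ∷ c≢zs) ∷ e≢zs ∷ _) (there (there a∈zs)) =
          colour-two-nonedges 0<d zs C↭ a≁b c≁e a∈zs
            (≢-sym (All.lookup c≢zs a∈zs)) (≢-sym (All.lookup e≢zs a∈zs)) b≢c small

      colour : _ → Colours d C
      colour (inj₁ c) = contradiction (no-clique C c)
        (<⇒≱ (enclosed⇒large (∈S (there (here refl))) (enclosed (here refl)) (there (here refl))))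
      colour (inj₂ (a , b , ys , p , a≁b)) =
        in-K (nonedge-K-large (∈-resp-↭ (↭-sym p) (here refl)) (∈-resp-↭ (↭-sym p) (there (here refl)))
               (head-≢ (Unique-resp-↭ p distinct)) a≁b)
             (clique-or-nonedge K)
        where
        in-K : 1 + d ≤ length K → _ → Colours d C
        in-K d<K (inj₁ c) = contradiction (no-clique K c) (<⇒≱ d<K)
        in-K d<K (inj₂ (a , b , ys , p , a≁b)) with clique-or-nonedge (x ∷ a ∷ ys)
        ... | inj₁ c = contradiction (no-clique (x ∷ a ∷ ys) c)
                (<⇒≱ (subst (1 + d ≤_) (↭-length p) d<K))
        ... | inj₂ (c , e , zs , q , c≁e) = with-two-nonedges p a≁b q c≁e

  -- Induction on the number of vertices.

  module _ {d} (4≤d : 4 ≤ d) (short : ∀ {m} → HasCycle G m → m ≤ 2 + d)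
           (no-clique : ∀ xs → AllPairs _~_ xs → length xs ≤ d) where

    0<d : 0 < d
    0<d = ≤-trans (s≤s z≤n) 4≤d

    ¬¬-colours : ∀ n S → length S ≤ n → Unique S → ¬ ¬ Colours d S
    ¬¬-colours n []          _  _  none = none ((λ _ → fromℕ< 0<d) , λ ())
    ¬¬-colours (suc n) S@(s ∷ _) S≤ uS none
      with all? (λ v → d ≤? length (filter (v ~?_) S)) S
    -- A vertex of degree below `d` is removed and coloured last.
    ... | no ¬all with v , v∈S , d≰ ← find (¬All⇒Any¬ (λ v → d ≤? length (filter (v ~?_) S)) S ¬all) =
      ¬¬-colours n (S ─ [ v ]) (≤-pred (≤-trans (─-shorter v∈S (here refl)) S≤))
        (─-unique [ v ] uS)
        λ f → none (colour-extend v∈S (≰⇒> d≰) f)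
    -- With all degrees at least `d`, a lobe is cut off; its vertex `x` stays in both pieces.
    ... | yes deg = ¬¬-lobe uS (All.lookup deg) 4≤d short (here refl) λ l → let open Lobe l in
      ¬¬-colours n (S ─ (v ∷ T)) (≤-pred (≤-trans (─-shorter (All.head (All.tail inside)) (here refl)) S≤))
        (─-unique (v ∷ T) uS)
        λ f → none (colour-glue (All.head inside)
          (λ x∈K → All.lookup (AllPairs.head distinct) x∈K refl)
          (λ u∈K → enclosed u∈K) (colour-lobe uS (All.lookup deg) 0<d no-clique l) f)

    χ≤ : χ G ≤ d
    χ≤ = decidable-stable (χ G ≤? d) λ χ≰d →
      ¬¬-colours _ (allFin order) ≤-refl (Unique.allFin⁺ order) λ (f , f≢) →
        χ≰d (χ-least G (f , λ u v → f≢ (∈-allFin u) (∈-allFin v)))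

  -- Cycle lengths and the choice of `d`.

  length-L≤ : length (L G) ≤ ℓ G ∸ 2
  length-L≤ = begin
    length (L G)                       ≤⟨ ⊆⇒length≤ (L-unique G) L⊆ ⟩
    length (map (3 +_) (upTo (ℓ G ∸ 2))) ≡⟨ length-map (3 +_) (upTo (ℓ G ∸ 2)) ⟩
    length (upTo (ℓ G ∸ 2))            ≡⟨ length-upTo (ℓ G ∸ 2) ⟩
    ℓ G ∸ 2                            ∎
    where
    open ≤-Reasoning

    -- Lengths range from 3 to `ℓ G`, which leaves `ℓ G ∸ 2` values.
    L⊆ : L G ⊆ map (3 +_) (upTo (ℓ G ∸ 2))
    L⊆ {m} m∈L with h@(_ , isCycle 3≤m _ _ , refl) ← ∈-L⁻ G m∈L =
      subst (_∈ map (3 +_) (upTo (ℓ G ∸ 2))) (m+[n∸m]≡n 3≤m)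
        (∈-map⁺ (3 +_) (∈-upTo⁺
          (≤-trans (≤-reflexive (sym (+-∸-assoc 1 3≤m))) (∸-monoˡ-≤ 2 (ℓ-longest G h)))))

theorem12 : (G : Graph) → Connected G → 4 ≤ length (L G) →
    (i : ℕ) → i ≤ 2 →
    ¬ (i ≡ 2 × length (Lₒ G) ≡ 3 × length (Lₑ G) ≡ 2) →
    w G ≤ (ℓ G ∸ i) → χ G ≤ (ℓ G ∸ i)
theorem12 G _ 4≤L i i≤2 _ w≤ = χ≤ G
  -- Here `d` is `ℓ G ∸ i`. It is at least `ℓ G ∸ 2`, hence at least 4, and `ℓ G` is at most
  -- `i + d`, hence at most `2 + d`.
  (≤-trans (≤-trans 4≤L (length-L≤ G)) (∸-monoʳ-≤ (ℓ G) i≤2))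
  (λ h → ≤-trans (ℓ-longest G h) (≤-trans (m≤n+m∸n (ℓ G) i) (+-monoˡ-≤ (ℓ G ∸ i) i≤2)))
  (λ xs c → let _ , clique , xs≤k = ∃Clique G xs c in ≤-trans xs≤k (≤-trans (w-largest G clique) w≤))
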